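{- There exist absolute constants $C,c>0$ and $m_0$ such that for every $m\ge m_0$ there is a set function $f:2^{[m]}\to\mathbb{R}_{\ge 0}$ with $f(\emptyset)=0$ whose $W$-distance from coverage is at most $C\,m^2/2^m$ and whose distance to coverage is at least $c$.
   Context: $[m]=\{1,\dots,m\}$. A function $f:2^{[m]}\to\mathbb{R}_{\ge 0}$ is a coverage function if there exist a finite set $U$, weights $w_u\ge 0$ for $u\in U$, and sets $A_1,\dots,A_m\subseteq U$ such that $f(T)=\sum_{u\in\bigcup_{i\in T}A_i} w_u$ for all $T\subseteq[m]$. The $W$-coefficients of a set function $f$ with $f(\emptyset)=0$ are, for each non-empty $S\subseteq[m]$, $w(S)=\sum_{T:\,S\cup T=[m]}(-1)^{|S\cap T|+1}f(T)$. The $W$-distance of $f$ from coverage is the fraction of its $2^m-1$ $W$-coefficients that are negative. The (usual) distance of $f$ to coverage is the minimum over coverage functions $g:2^{[m]}\to\mathbb{R}_{\ge0}$ of $2^{ -m}\,|\{T\subseteq[m]: f(T)\ne g(T)\}|$. -}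

module Defs where

open import Data.Nat as ℕ using (ℕ; zero; suc)
import Data.Nat.Properties as ℕ
open import Data.Integer as ℤ using (+_; -1ℤ)
open import Data.Rational as ℚ using (ℚ; 0ℚ; 1ℚ; ½; 1/_; ∣_∣)
import Data.Rational.Properties as ℚ
open import Data.Rational.Solver using (module +-*-Solver)
open import Data.Bool using () renaming (_≟_ to _≟ᵇ_)
open import Data.Fin using (Fin)
open import Data.Fin.Subset as Subset using (Subset; inside; outside; ⊤; ⋃; _∩_; _∪_; Nonempty)
open import Data.Fin.Subset.Properties using (_∈?_)
open import Data.List as List using (List; []; _∷_; _++_; map; filter; foldr; length; allFin)
open import Data.List.Membership.Propositional using () renaming (_∈_ to _∈ˡ_)
open import Data.List.Relation.Unary.Unique.Propositional using (Unique)
open import Data.Product using (Σ; ∃; _×_; _,_; proj₁; proj₂)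
open import Data.Vec as Vec using ()
open import Data.Vec.Properties using (≡-dec)
open import Function.Bundles using (_⇔_)
open import Relation.Binary.Definitions using (DecidableEquality)
open import Relation.Binary.PropositionalEquality
open import Relation.Nullary using (¬_)

------------------------------------------------------------------------
-- Real numbers: Cauchy sequences of rationals, with setoid equality _≈_.

IsCauchy : (ℕ → ℚ) → Set
IsCauchy x = ∀ ε → 0ℚ ℚ.< ε →
  ∃ λ N → ∀ i j → N ℕ.≤ i → N ℕ.≤ j → ∣ x i ℚ.- x j ∣ ℚ.≤ ε

record ℝ : Set where
  constructor mkℝ
  field
    seq    : ℕ → ℚ
    cauchy : IsCauchy seq

open ℝ public

infix 4 _≈_ _≤ᴿ_ _<ᴿ_

_≈_ : ℝ → ℝ → Set
x ≈ y = ∀ ε → 0ℚ ℚ.< ε → ∃ λ N → ∀ i → N ℕ.≤ i → ∣ seq x i ℚ.- seq y i ∣ ℚ.≤ ε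

_≤ᴿ_ : ℝ → ℝ → Set
x ≤ᴿ y = ∀ ε → 0ℚ ℚ.< ε → ∃ λ N → ∀ i → N ℕ.≤ i → seq x i ℚ.≤ seq y i ℚ.+ ε

_<ᴿ_ : ℝ → ℝ → Set
x <ᴿ y = ∃ λ ε → 0ℚ ℚ.< ε × ∃ λ N → ∀ i → N ℕ.≤ i → seq x i ℚ.+ ε ℚ.≤ seq y i

private
  open +-*-Solver

  minus-+ : ∀ a b c d → (a ℚ.+ b) ℚ.- (c ℚ.+ d) ≡ (a ℚ.- c) ℚ.+ (b ℚ.- d)
  minus-+ = solve 4 (λ a b c d → (a :+ b) :- (c :+ d) := (a :- c) :+ (b :- d)) refl

  minus-* : ∀ q a b → q ℚ.* a ℚ.- q ℚ.* b ≡ q ℚ.* (a ℚ.- b)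
  minus-* = solve 3 (λ q a b → q :* a :- q :* b := q :* (a :- b)) refl

  halves : ∀ ε → ε ℚ.* ½ ℚ.+ ε ℚ.* ½ ≡ ε
  halves ε = trans (sym (ℚ.*-distribˡ-+ ε ½ ½)) (ℚ.*-identityʳ ε)

  half-pos : ∀ {ε} → 0ℚ ℚ.< ε → 0ℚ ℚ.< ε ℚ.* ½
  half-pos {ε} ε>0 = ℚ.positive⁻¹ _ {{ℚ.pos*pos⇒pos ε {{ℚ.positive ε>0}} ½}}

  const-cauchy : ∀ q → IsCauchy (λ _ → q)
  const-cauchy q ε ε>0 = 0 , λ _ _ _ _ →
    subst (λ z → ∣ z ∣ ℚ.≤ ε) (sym (ℚ.+-inverseʳ q)) (ℚ.<⇒≤ ε>0)

  +-cauchy : ∀ x y → IsCauchy x → IsCauchy y → IsCauchy (λ n → x n ℚ.+ y n)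
  +-cauchy x y cx cy ε ε>0
    with cx (ε ℚ.* ½) (half-pos ε>0) | cy (ε ℚ.* ½) (half-pos ε>0)
  ... | M , p | N , q = M ℕ.⊔ N , λ i j i≥ j≥ → begin
      ∣ (x i ℚ.+ y i) ℚ.- (x j ℚ.+ y j) ∣    ≡⟨ cong ∣_∣ (minus-+ (x i) (y i) (x j) (y j)) ⟩
      ∣ (x i ℚ.- x j) ℚ.+ (y i ℚ.- y j) ∣    ≤⟨ ℚ.∣p+q∣≤∣p∣+∣q∣ (x i ℚ.- x j) (y i ℚ.- y j) ⟩
      ∣ x i ℚ.- x j ∣ ℚ.+ ∣ y i ℚ.- y j ∣    ≤⟨ ℚ.+-mono-≤
        (p i j (ℕ.m⊔n≤o⇒m≤o M N i≥) (ℕ.m⊔n≤o⇒m≤o M N j≥))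
        (q i j (ℕ.m⊔n≤o⇒n≤o M N i≥) (ℕ.m⊔n≤o⇒n≤o M N j≥)) ⟩
      ε ℚ.* ½ ℚ.+ ε ℚ.* ½                    ≡⟨ halves ε ⟩
      ε                                      ∎
    where open ℚ.≤-Reasoning

  •-cauchy : ∀ q x → IsCauchy x → IsCauchy (λ n → q ℚ.* x n)
  •-cauchy q x cx ε ε>0 = proj₁ (cx δ δ>0) , λ i j i≥ j≥ → begin
      ∣ q ℚ.* x i ℚ.- q ℚ.* x j ∣   ≡⟨ cong ∣_∣ (minus-* q (x i) (x j)) ⟩
      ∣ q ℚ.* (x i ℚ.- x j) ∣       ≡⟨ ℚ.∣p*q∣≡∣p∣*∣q∣ q (x i ℚ.- x j) ⟩
      ∣ q ∣ ℚ.* ∣ x i ℚ.- x j ∣     ≤⟨ ℚ.*-monoʳ-≤-nonNeg ∣ x i ℚ.- x j ∣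
        {{ℚ.nonNegative (ℚ.0≤∣p∣ (x i ℚ.- x j))}} ∣q∣≤s ⟩
      s ℚ.* ∣ x i ℚ.- x j ∣         ≤⟨ ℚ.*-monoˡ-≤-nonNeg s {{ℚ.pos⇒nonNeg s}} (proj₂ (cx δ δ>0) i j i≥ j≥) ⟩
      s ℚ.* (1/ s ℚ.* ε)            ≡⟨ ℚ.*-assoc s (1/ s) ε ⟨
      (s ℚ.* 1/ s) ℚ.* ε            ≡⟨ cong (ℚ._* ε) (ℚ.*-inverseʳ s) ⟩
      1ℚ ℚ.* ε                      ≡⟨ ℚ.*-identityˡ ε ⟩
      ε                             ∎
    where
    open ℚ.≤-Reasoning
    s : ℚ
    s = 1ℚ ℚ.+ ∣ q ∣
    instance
      s-pos : ℚ.Positive s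
      s-pos = ℚ.positive (ℚ.+-mono-<-≤ (ℚ.positive⁻¹ 1ℚ) (ℚ.0≤∣p∣ q))
      s≢0 : ℚ.NonZero s
      s≢0 = ℚ.pos⇒nonZero s
    δ : ℚ
    δ = 1/ s ℚ.* ε
    δ>0 : 0ℚ ℚ.< δ
    δ>0 = ℚ.positive⁻¹ δ
      {{ℚ.pos*pos⇒pos (1/ s) {{ℚ.1/pos⇒pos s}} ε {{ℚ.positive ε>0}}}}
    ∣q∣≤s : ∣ q ∣ ℚ.≤ s
    ∣q∣≤s = subst (ℚ._≤ s) (ℚ.+-identityˡ ∣ q ∣)
      (ℚ.+-monoˡ-≤ ∣ q ∣ (ℚ.<⇒≤ (ℚ.positive⁻¹ 1ℚ)))

infixl 6 _+ᴿ_
infixr 7 _•_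

ι : ℚ → ℝ
ι q = mkℝ (λ _ → q) (const-cauchy q)

0ᴿ : ℝ
0ᴿ = ι 0ℚ

_+ᴿ_ : ℝ → ℝ → ℝ
x +ᴿ y = mkℝ (λ n → seq x n ℚ.+ seq y n) (+-cauchy (seq x) (seq y) (cauchy x) (cauchy y))

_•_ : ℚ → ℝ → ℝ
q • x = mkℝ (λ n → q ℚ.* seq x n) (•-cauchy q (seq x) (cauchy x))

sumᴿ : List ℝ → ℝ
sumᴿ = foldr _+ᴿ_ 0ᴿ

------------------------------------------------------------------------
-- Counting

-- HasCard P k : exactly k elements of A satisfy P.  It is a relation because
-- P (e.g. an inequality of reals) need not be decidable.
HasCard : {A : Set} → (A → Set) → ℕ → Set
HasCard {A} P k = Σ (List A) λ xs →
  Unique xs × (∀ a → P a ⇔ (a ∈ˡ xs)) × length xs ≡ k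

-- Convention: k over 0 is 0.
_over_ : ℕ → ℕ → ℚ
k over zero  = 0ℚ
k over suc d = + k ℚ./ suc d

------------------------------------------------------------------------
-- Set functions; [m] is Fin m.

record SetFunction (m : ℕ) : Set where
  field
    value  : Subset m → ℝ
    nonNeg : ∀ T → 0ᴿ ≤ᴿ value T

open SetFunction public

subsets : ∀ m → List (Subset m)
subsets zero    = Vec.[] ∷ []
subsets (suc m) = map (outside Vec.∷_) (subsets m) ++ map (inside Vec.∷_) (subsets m)

_≟ˢ_ : ∀ {m} → DecidableEquality (Subset m)
_≟ˢ_ = ≡-dec _≟ᵇ_

-- ⋃_{i ∈ T} A i
unionOver : ∀ {m n} → (Fin m → Subset n) → Subset m → Subset n
unionOver {m} A T = ⋃ (map A (filter (_∈? T) (allFin m)))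

-- Σ_{u ∈ X} w u
weightOf : ∀ {n} → (Fin n → ℝ) → Subset n → ℝ
weightOf {n} w X = sumᴿ (map w (filter (_∈? X) (allFin n)))

-- The finite universe U is taken to be Fin n.
IsCoverage : ∀ {m} → SetFunction m → Set
IsCoverage {m} f =
  Σ ℕ λ n → Σ (Fin n → ℝ) λ w → Σ (Fin m → Subset n) λ A →
    (∀ u → 0ᴿ ≤ᴿ w u) × (∀ T → value f T ≈ weightOf w (unionOver A T))

wCoeff : ∀ {m} → SetFunction m → Subset m → ℝ
wCoeff {m} f S = sumᴿ (map
  (λ T → ((-1ℤ ℤ.^ suc (Subset.∣ S ∩ T ∣)) ℚ./ 1) • value f T)
  (filter (λ T → (S ∪ T) ≟ˢ ⊤) (subsets m)))

-- WDistance f q : the W-distance of f from coverage is q.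
WDistance : ∀ {m} → SetFunction m → ℚ → Set
WDistance {m} f q = ∃ λ k →
  HasCard (λ S → Nonempty S × wCoeff f S <ᴿ 0ᴿ) k × q ≡ k over (2 ℕ.^ m ℕ.∸ 1)

-- Hamming f g q : f and g differ on a fraction q of all subsets of [m].
Hamming : ∀ {m} → SetFunction m → SetFunction m → ℚ → Set
Hamming {m} f g q = ∃ λ k →
  HasCard (λ T → ¬ (value f T ≈ value g T)) k × q ≡ k over (2 ℕ.^ m)

-- CoverageDistance f d : d is the minimum of the Hamming distances from f to
-- coverage functions (attained, and a lower bound).
CoverageDistance : ∀ {m} → SetFunction m → ℚ → Set
CoverageDistance {m} f d =
  (Σ (SetFunction m) λ g → IsCoverage g × Hamming f g d) ×
  (∀ (g : SetFunction m) → IsCoverage g → ∀ q → Hamming f g q → d ℚ.≤ q)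

{-# OPTIONS --safe #-}
module Submission where

-- Let f(T) = 1 if T is non-empty and avoids one fixed element e of [m], and
-- f(T) = 0 otherwise.  Its W-coefficients are w([m]) = 1, w({e}) = -1 and 0
-- elsewhere, so only one of them is negative.  Coverage functions are monotone,
-- but f drops from 1 to 0 between T and T ∪ {e} whenever T ≠ ∅ avoids e; these
-- 2^(m-1) - 1 disjoint pairs each contain a disagreement with any coverage
-- function, and the zero function attains this bound.

open import Defs
open import Data.Nat using (ℕ; _≤_; _^_)
open import Data.Rational using (ℚ)
open import Data.Fin.Subset using (⊥)
open import Data.Product using (Σ; _×_)

open import Data.Bool using (true; false)
open import Data.Empty using () renaming (⊥-elim to absurd)
open import Data.Fin as Fin using (Fin)
open import Data.Fin.Subset as Subset
  using (Subset; inside; outside; ⊤; ⋃; _∪_; _∩_; _∈_; _⊆_; Nonempty)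
open import Data.Fin.Subset.Properties
  using (_∈?_; ∉⊥; out⊆; x∈p∪q⁺; x∈p∪q⁻; ⊆-refl; drop-there; Empty-unique)
open import Data.Integer as ℤ using (+_; -1ℤ; 1ℤ)
import Data.Integer.Properties as ℤ
open import Data.List using (List; []; _∷_; _++_; map; filter; foldr; length; allFin)
open import Data.List.Properties using (length-map; length-++; map-++; filter-++)
open import Data.List.Membership.Propositional using () renaming (_∈_ to _∈ˡ_)
open import Data.List.Membership.Propositional.Properties
  using (∈-map⁺; ∈-map⁻; ∈-++⁺ˡ; ∈-++⁺ʳ; ∈-++⁻; ∈-∃++; ∈-filter⁺; ∈-filter⁻; ∈-allFin)
open import Data.List.Relation.Unary.All as All using ()
open import Data.List.Relation.Unary.Any using (here; there)
open import Data.List.Relation.Unary.AllPairs using ([]; _∷_)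
open import Data.List.Relation.Unary.Unique.Propositional using (Unique)
import Data.List.Relation.Unary.Unique.Propositional.Properties as Unique
open import Data.List.Relation.Binary.Sublist.Propositional as Sublist using ([]; _∷_; _∷ʳ_)
import Data.List.Relation.Binary.Sublist.Propositional.Properties as Sublist
import Data.Nat as ℕ
import Data.Nat.Properties as ℕ
open import Data.Product using (∃; _,_; proj₁; proj₂)
open import Data.Rational as ℚ using (0ℚ; 1ℚ; ½; ∣_∣)
import Data.Rational.Properties as ℚ
open import Data.Rational.Solver using (module +-*-Solver)
import Data.Rational.Unnormalised as ℚᵘ
import Data.Rational.Unnormalised.Properties as ℚᵘ
open import Data.Sum using (_⊎_; inj₁; inj₂)
open import Data.Vec as Vec using (_∷_; [])
open import Data.Vec.Properties using (∷-injectiveʳ)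
open import Function using (_∘_)
open import Function.Bundles using (mk⇔; Equivalence)
open import Relation.Binary.PropositionalEquality
open import Relation.Nullary using (¬_; yes; no; does; contradiction)
open import Relation.Nullary.Decidable using (from-yes; from-no)

open +-*-Solver

-- Order on ℝ

halves : ∀ ε → ε ℚ.* ½ ℚ.+ ε ℚ.* ½ ≡ ε
halves ε = trans (sym (ℚ.*-distribˡ-+ ε ½ ½)) (ℚ.*-identityʳ ε)

half-pos : ∀ {ε} → 0ℚ ℚ.< ε → 0ℚ ℚ.< ε ℚ.* ½
half-pos {ε} ε>0 = ℚ.positive⁻¹ _ {{ℚ.pos*pos⇒pos ε {{ℚ.positive ε>0}} ½}}

≤⇒≤+pos : ∀ {p q ε} → 0ℚ ℚ.< ε → p ℚ.≤ q → p ℚ.≤ q ℚ.+ ε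
≤⇒≤+pos {p} ε>0 p≤q = subst (ℚ._≤ _) (ℚ.+-identityʳ p) (ℚ.+-mono-≤ p≤q (ℚ.<⇒≤ ε>0))

ι-mono-≤ : ∀ p q → p ℚ.≤ q → ι p ≤ᴿ ι q
ι-mono-≤ _ _ p≤q ε ε>0 = 0 , λ _ _ → ≤⇒≤+pos ε>0 p≤q

ι-mono-< : ∀ p q → p ℚ.< q → ι p <ᴿ ι q
ι-mono-< p q p<q = q ℚ.- p , gap>0 , 0 , λ _ _ → ℚ.≤-reflexive (cancel p q)
  where
  cancel : ∀ p q → p ℚ.+ (q ℚ.- p) ≡ q
  cancel = solve 2 (λ p q → p :+ (q :- p) := q) refl
  gap>0 : 0ℚ ℚ.< q ℚ.- p
  gap>0 = subst (ℚ._< q ℚ.- p) (ℚ.+-inverseʳ p) (ℚ.+-monoˡ-< (ℚ.- p) p<q)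

≈-refl : ∀ {x} → x ≈ x
≈-refl {x} ε ε>0 = 0 , λ i _ →
  subst (λ z → ∣ z ∣ ℚ.≤ ε) (sym (ℚ.+-inverseʳ (seq x i))) (ℚ.<⇒≤ ε>0)

≈-sym : ∀ {x y} → x ≈ y → y ≈ x
≈-sym {x} {y} x≈y ε ε>0 = proj₁ (x≈y ε ε>0) , λ i i≥ →
  subst (ℚ._≤ ε) (trans (sym (ℚ.∣-p∣≡∣p∣ (seq x i ℚ.- seq y i))) (cong ∣_∣ (swap (seq x i) (seq y i))))
    (proj₂ (x≈y ε ε>0) i i≥)
  where
  swap : ∀ a b → ℚ.- (a ℚ.- b) ≡ b ℚ.- a
  swap = solve 2 (λ a b → :- (a :- b) := b :- a) refl

p≤∣p∣ : ∀ p → p ℚ.≤ ∣ p ∣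
p≤∣p∣ p with ℚ.∣p∣≡p∨∣p∣≡-p p
... | inj₁ eq = ℚ.≤-reflexive (sym eq)
... | inj₂ eq = ℚ.≤-trans
  (subst₂ ℚ._≤_ (solve 1 (λ p → :- (:- p) := p) refl p) refl (ℚ.neg-antimono-≤ (subst (0ℚ ℚ.≤_) eq (ℚ.0≤∣p∣ p))))
  (ℚ.0≤∣p∣ p)

≈⇒≤ᴿ : ∀ {x y} → x ≈ y → x ≤ᴿ y
≈⇒≤ᴿ {x} {y} x≈y ε ε>0 = proj₁ (x≈y ε ε>0) , λ i i≥ → begin
    seq x i                                ≡⟨ cancel (seq x i) (seq y i) ⟩
    seq y i ℚ.+ (seq x i ℚ.- seq y i)      ≤⟨ ℚ.+-monoʳ-≤ (seq y i) (p≤∣p∣ (seq x i ℚ.- seq y i)) ⟩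
    seq y i ℚ.+ ∣ seq x i ℚ.- seq y i ∣    ≤⟨ ℚ.+-monoʳ-≤ (seq y i) (proj₂ (x≈y ε ε>0) i i≥) ⟩
    seq y i ℚ.+ ε                          ∎
  where
  open ℚ.≤-Reasoning
  cancel : ∀ a b → a ≡ b ℚ.+ (a ℚ.- b)
  cancel = solve 2 (λ a b → a := b :+ (a :- b)) refl

≤ᴿ-trans : ∀ {x y z} → x ≤ᴿ y → y ≤ᴿ z → x ≤ᴿ z
≤ᴿ-trans {x} {y} {z} x≤y y≤z ε ε>0
  with x≤y (ε ℚ.* ½) (half-pos ε>0) | y≤z (ε ℚ.* ½) (half-pos ε>0)
... | M , p | N , q = M ℕ.⊔ N , λ i i≥ → begin
    seq x i                               ≤⟨ p i (ℕ.m⊔n≤o⇒m≤o M N i≥) ⟩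
    seq y i ℚ.+ ε ℚ.* ½                   ≤⟨ ℚ.+-monoˡ-≤ (ε ℚ.* ½) (q i (ℕ.m⊔n≤o⇒n≤o M N i≥)) ⟩
    (seq z i ℚ.+ ε ℚ.* ½) ℚ.+ ε ℚ.* ½     ≡⟨ trans (ℚ.+-assoc (seq z i) _ _) (cong (seq z i ℚ.+_) (halves ε)) ⟩
    seq z i ℚ.+ ε                         ∎
  where open ℚ.≤-Reasoning

+ᴿ-mono-≤ : ∀ {x y u v} → x ≤ᴿ y → u ≤ᴿ v → (x +ᴿ u) ≤ᴿ (y +ᴿ v)
+ᴿ-mono-≤ {x} {y} {u} {v} x≤y u≤v ε ε>0
  with x≤y (ε ℚ.* ½) (half-pos ε>0) | u≤v (ε ℚ.* ½) (half-pos ε>0)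
... | M , p | N , q = M ℕ.⊔ N , λ i i≥ → begin
    seq x i ℚ.+ seq u i                               ≤⟨ ℚ.+-mono-≤
      (p i (ℕ.m⊔n≤o⇒m≤o M N i≥)) (q i (ℕ.m⊔n≤o⇒n≤o M N i≥)) ⟩
    (seq y i ℚ.+ ε ℚ.* ½) ℚ.+ (seq v i ℚ.+ ε ℚ.* ½)   ≡⟨ regroup (seq y i) (seq v i) (ε ℚ.* ½) ⟩
    (seq y i ℚ.+ seq v i) ℚ.+ (ε ℚ.* ½ ℚ.+ ε ℚ.* ½)   ≡⟨ cong (seq y i ℚ.+ seq v i ℚ.+_) (halves ε) ⟩
    (seq y i ℚ.+ seq v i) ℚ.+ ε                       ∎
  where
  open ℚ.≤-Reasoning
  regroup : ∀ a b δ → (a ℚ.+ δ) ℚ.+ (b ℚ.+ δ) ≡ (a ℚ.+ b) ℚ.+ (δ ℚ.+ δ)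
  regroup = solve 3 (λ a b δ → (a :+ δ) :+ (b :+ δ) := (a :+ b) :+ (δ :+ δ)) refl

≤ᴿ-refl : ∀ {x} → x ≤ᴿ x
≤ᴿ-refl ε ε>0 = 0 , λ i _ → ≤⇒≤+pos ε>0 ℚ.≤-refl

0≤⇒≤+ᴿ : ∀ {x y w} → 0ᴿ ≤ᴿ w → x ≤ᴿ y → x ≤ᴿ (w +ᴿ y)
0≤⇒≤+ᴿ {x} {y} {w} 0≤w x≤y ε ε>0 = proj₁ sum≤ , λ i i≥ →
  ℚ.≤-trans (ℚ.≤-reflexive (sym (ℚ.+-identityˡ (seq x i)))) (proj₂ sum≤ i i≥)
  where
  sum≤ = +ᴿ-mono-≤ {0ᴿ} {w} {x} {y} 0≤w x≤y ε ε>0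

ι1≰ι0 : ¬ (ι 1ℚ ≤ᴿ ι 0ℚ)
ι1≰ι0 1≤0 with 1≤0 ½ (ℚ.positive⁻¹ ½)
... | N , p = from-no (1ℚ ℚ.≤? ½) (subst (1ℚ ℚ.≤_) (ℚ.+-identityˡ ½) (p N ℕ.≤-refl))

-- Monotonicity of coverage functions

∈⋃⁺ : ∀ {n x} {p : Subset n} {ps} → p ∈ˡ ps → x ∈ p → x ∈ ⋃ ps
∈⋃⁺ (here refl) x∈p = x∈p∪q⁺ (inj₁ x∈p)
∈⋃⁺ (there p∈ps) x∈p = x∈p∪q⁺ (inj₂ (∈⋃⁺ p∈ps x∈p))

∈⋃⁻ : ∀ {n x} (ps : List (Subset n)) → x ∈ ⋃ ps → ∃ λ p → p ∈ˡ ps × x ∈ p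
∈⋃⁻ [] x∈ = absurd (∉⊥ x∈)
∈⋃⁻ (p ∷ ps) x∈ with x∈p∪q⁻ p (⋃ ps) x∈
... | inj₁ x∈p = p , here refl , x∈p
... | inj₂ x∈ps with ∈⋃⁻ ps x∈ps
...   | q , q∈ps , x∈q = q , there q∈ps , x∈q

unionOver-mono : ∀ {m n} (A : Fin m → Subset n) {S T} → S ⊆ T → unionOver A S ⊆ unionOver A T
unionOver-mono {m} A {S} {T} S⊆T x∈ with ∈⋃⁻ (map A (filter (_∈? S) (allFin m))) x∈
... | p , p∈ , x∈p with ∈-map⁻ A p∈
...   | i , i∈ , refl =
  ∈⋃⁺ (∈-map⁺ A (∈-filter⁺ (_∈? T) (∈-allFin i) (S⊆T (proj₂ (∈-filter⁻ (_∈? S) {xs = allFin m} i∈))))) x∈p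

-- Each skipped entry contributes a non-negative weight, and each kept entry contributes equally to
-- both sides. The sublist relation supplies exactly this induction, and filters by nested
-- predicates give such sublists.
sumᴿ-sublist-≤ : ∀ {A : Set} (w : A → ℝ) → (∀ u → 0ᴿ ≤ᴿ w u) →
  ∀ {us vs} → us Sublist.⊆ vs → sumᴿ (map w us) ≤ᴿ sumᴿ (map w vs)
sumᴿ-sublist-≤ w w≥0 [] = ≤ᴿ-refl {0ᴿ}
sumᴿ-sublist-≤ w w≥0 {us} {v ∷ vs} (.v ∷ʳ us⊆vs) =
  0≤⇒≤+ᴿ {sumᴿ (map w us)} {sumᴿ (map w vs)} {w v} (w≥0 v) (sumᴿ-sublist-≤ w w≥0 us⊆vs)
sumᴿ-sublist-≤ w w≥0 {u ∷ us} {.u ∷ vs} (refl ∷ us⊆vs) =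
  +ᴿ-mono-≤ {w u} {w u} {sumᴿ (map w us)} {sumᴿ (map w vs)} (≤ᴿ-refl {w u}) (sumᴿ-sublist-≤ w w≥0 us⊆vs)

weightOf-mono : ∀ {n} (w : Fin n → ℝ) → (∀ u → 0ᴿ ≤ᴿ w u) →
  ∀ {X Y} → X ⊆ Y → weightOf w X ≤ᴿ weightOf w Y
weightOf-mono {n} w w≥0 {X} {Y} X⊆Y =
  sumᴿ-sublist-≤ w w≥0 {filter (_∈? X) (allFin n)} {filter (_∈? Y) (allFin n)}
    (Sublist.filter⁺ (_∈? X) (_∈? Y) {allFin n} {allFin n} (λ { refl → X⊆Y }) Sublist.⊆-refl)

-- Enlarging the index set enlarges the union, which only adds non-negative weights. The values of
-- `g` match these weights only up to `≈`, hence the two outer conversions.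
coverage-mono : ∀ {m} (g : SetFunction m) → IsCoverage g → ∀ {S T} → S ⊆ T → value g S ≤ᴿ value g T
coverage-mono g (n , w , A , w≥0 , g≈) {S} {T} S⊆T =
  ≤ᴿ-trans {value g S} {W S} {value g T} (≈⇒≤ᴿ {value g S} {W S} (g≈ S))
    (≤ᴿ-trans {W S} {W T} {value g T} (weightOf-mono w w≥0 (unionOver-mono A S⊆T))
      (≈⇒≤ᴿ {W T} {value g T} (≈-sym {value g T} {W T} (g≈ T))))
  where
  W : Subset _ → ℝ
  W T = weightOf w (unionOver A T)

-- Counting

-- Pigeonhole by deletion: one occurrence of the head is removed from `ys`, and the tail of `xs`,
-- which does not contain the head, still lies in what remains.
Unique⇒length≤ : {A : Set} {xs : List A} → Unique xs → (ys : List A) →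
  (∀ {x} → x ∈ˡ xs → x ∈ˡ ys) → length xs ≤ length ys
Unique⇒length≤ [] ys xs⊆ys = ℕ.z≤n
Unique⇒length≤ {xs = x ∷ xs} (x∉xs ∷ uxs) ys xs⊆ys with ∈-∃++ (xs⊆ys (here refl))
... | as , bs , refl = begin
    ℕ.suc (length xs)                 ≤⟨ ℕ.s≤s (Unique⇒length≤ uxs (as ++ bs) xs⊆) ⟩
    ℕ.suc (length (as ++ bs))         ≡⟨ cong ℕ.suc (length-++ as) ⟩
    ℕ.suc (length as ℕ.+ length bs)   ≡⟨ ℕ.+-suc (length as) (length bs) ⟨
    length as ℕ.+ ℕ.suc (length bs)   ≡⟨ length-++ as ⟨
    length (as ++ x ∷ bs)             ∎
  where
  open ℕ.≤-Reasoning
  xs⊆ : ∀ {y} → y ∈ˡ xs → y ∈ˡ as ++ bs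
  xs⊆ y∈ with ∈-++⁻ as (xs⊆ys (there y∈))
  ... | inj₁ y∈as = ∈-++⁺ˡ y∈as
  ... | inj₂ (here refl) = contradiction refl (All.lookup x∉xs y∈)
  ... | inj₂ (there y∈bs) = ∈-++⁺ʳ as y∈bs

Unique-outside++inside : ∀ {n} {xs ys : List (Subset n)} → Unique xs → Unique ys →
  Unique (map (outside ∷_) xs ++ map (inside ∷_) ys)
Unique-outside++inside uxs uys = Unique.++⁺ (Unique.map⁺ ∷-injectiveʳ uxs) (Unique.map⁺ ∷-injectiveʳ uys)
  λ { (p , q) → case-both (∈-map⁻ (outside ∷_) p) (∈-map⁻ (inside ∷_) q) }
  where
  case-both : ∀ {n} {xs ys : List (Subset n)} {T} →
    (∃ λ x → x ∈ˡ xs × T ≡ outside ∷ x) → ¬ (∃ λ y → y ∈ˡ ys × T ≡ inside ∷ y)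
  case-both (_ , _ , refl) (_ , _ , ())

subsets-unique : ∀ n → Unique (subsets n)
subsets-unique ℕ.zero    = All.[] ∷ []
subsets-unique (ℕ.suc n) = Unique-outside++inside (subsets-unique n) (subsets-unique n)

∈-subsets : ∀ {n} (T : Subset n) → T ∈ˡ subsets n
∈-subsets []            = here refl
∈-subsets (outside ∷ T) = ∈-++⁺ˡ (∈-map⁺ (outside ∷_) (∈-subsets T))
∈-subsets (inside ∷ T)  = ∈-++⁺ʳ _ (∈-map⁺ (inside ∷_) (∈-subsets T))

length-outside++inside : ∀ {n} (xs ys : List (Subset n)) →
  length (map (outside ∷_) xs ++ map (inside ∷_) ys) ≡ length xs ℕ.+ length ys
length-outside++inside xs ys = trans (length-++ (map (outside ∷_) xs))
  (cong₂ ℕ._+_ (length-map (outside ∷_) xs) (length-map (inside ∷_) ys))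

length-subsets : ∀ n → length (subsets n) ≡ 2 ^ n
length-subsets ℕ.zero    = refl
length-subsets (ℕ.suc n) = trans (length-outside++inside (subsets n) (subsets n))
  (cong₂ ℕ._+_ (length-subsets n) (trans (length-subsets n) (sym (ℕ.+-identityʳ (2 ^ n)))))

-- This list does double duty: it indexes the disagreements with the zero function, and also the
-- disjoint pairs that force disagreements with an arbitrary coverage function.
nonemptySubsets : ∀ n → List (Subset n)
nonemptySubsets ℕ.zero    = []
nonemptySubsets (ℕ.suc n) = map (outside ∷_) (nonemptySubsets n) ++ map (inside ∷_) (subsets n)

nonemptySubsets-unique : ∀ n → Unique (nonemptySubsets n)
nonemptySubsets-unique ℕ.zero    = []
nonemptySubsets-unique (ℕ.suc n) = Unique-outside++inside (nonemptySubsets-unique n) (subsets-unique n)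

suc-length-nonemptySubsets : ∀ n → ℕ.suc (length (nonemptySubsets n)) ≡ 2 ^ n
suc-length-nonemptySubsets ℕ.zero    = refl
suc-length-nonemptySubsets (ℕ.suc n) =
  trans (cong ℕ.suc (length-outside++inside (nonemptySubsets n) (subsets n)))
    (cong₂ ℕ._+_ (suc-length-nonemptySubsets n)
      (trans (length-subsets n) (sym (ℕ.+-identityʳ (2 ^ n)))))

-- Cross-multiplication, carried out on unnormalised rationals because `ℚ./` reduces fractions to
-- lowest terms.
over-mono-≤ : ∀ a b d e → .{{ℕ.NonZero d}} → .{{ℕ.NonZero e}} →
  a ℕ.* e ≤ b ℕ.* d → a over d ℚ.≤ b over e
over-mono-≤ a b (ℕ.suc d) (ℕ.suc e) ae≤bd = ℚ.toℚᵘ-cancel-≤ (begin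
    ℚ.toℚᵘ (+ a ℚ./ ℕ.suc d)    ≃⟨ ℚ.toℚᵘ-fromℚᵘ (ℚᵘ.mkℚᵘ (+ a) d) ⟩
    ℚᵘ.mkℚᵘ (+ a) d             ≤⟨ ℚᵘ.*≤* (subst₂ ℤ._≤_ (ℤ.pos-* a (ℕ.suc e)) (ℤ.pos-* b (ℕ.suc d)) (ℤ.+≤+ ae≤bd)) ⟩
    ℚᵘ.mkℚᵘ (+ b) e             ≃⟨ ℚ.toℚᵘ-fromℚᵘ (ℚᵘ.mkℚᵘ (+ b) e) ⟨
    ℚ.toℚᵘ (+ b ℚ./ ℕ.suc e)    ∎)
  where open ℚᵘ.≤-Reasoning

-- Alternating sums defining the W-coefficients

sumℚ : List ℚ → ℚ
sumℚ = foldr ℚ._+_ 0ℚ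

term : ∀ {n} → Subset n → (Subset n → ℚ) → Subset n → ℚ
term S h T = ((-1ℤ ℤ.^ ℕ.suc (Subset.∣ S ∩ T ∣)) ℚ./ 1) ℚ.* h T

-- The list is a parameter so that the sum can be split along the two halves of `subsets`. Rational
-- values suffice, since real sums are computed index by index on the Cauchy sequences.
altSum : ∀ {n} → Subset n → (Subset n → ℚ) → List (Subset n) → ℚ
altSum S h xs = sumℚ (map (term S h) (filter (λ T → (S ∪ T) ≟ˢ ⊤) xs))

seq-sumᴿ : ∀ {A : Set} (F : A → ℝ) i xs → seq (sumᴿ (map F xs)) i ≡ sumℚ (map (λ a → seq (F a) i) xs)
seq-sumᴿ F i []       = refl
seq-sumᴿ F i (x ∷ xs) = cong (seq (F x) i ℚ.+_) (seq-sumᴿ F i xs)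

sumℚ-++ : ∀ xs ys → sumℚ (xs ++ ys) ≡ sumℚ xs ℚ.+ sumℚ ys
sumℚ-++ []       ys = sym (ℚ.+-identityˡ _)
sumℚ-++ (x ∷ xs) ys = trans (cong (x ℚ.+_) (sumℚ-++ xs ys)) (sym (ℚ.+-assoc x (sumℚ xs) (sumℚ ys)))

altSum-++ : ∀ {n} (S : Subset n) h xs ys → altSum S h (xs ++ ys) ≡ altSum S h xs ℚ.+ altSum S h ys
altSum-++ S h xs ys = trans
  (cong (sumℚ ∘ map (term S h)) (filter-++ P? xs ys))
  (trans (cong sumℚ (map-++ (term S h) (filter P? xs) (filter P? ys)))
         (sumℚ-++ (map (term S h) (filter P? xs)) _))
  where P? = λ T → (S ∪ T) ≟ˢ ⊤

-- The head lies in neither set, so no union is `⊤` and the filter discards every term.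
altSum-out-out : ∀ {n} (S : Subset n) h xs → altSum (outside ∷ S) h (map (outside ∷_) xs) ≡ 0ℚ
altSum-out-out S h []       = refl
altSum-out-out S h (T ∷ xs) = altSum-out-out S h xs

altSum-out-in : ∀ {n} (S : Subset n) h xs →
  altSum (outside ∷ S) h (map (inside ∷_) xs) ≡ altSum S (h ∘ (inside ∷_)) xs
altSum-out-in S h []       = refl
altSum-out-in S h (T ∷ xs) with does ((S ∪ T) ≟ˢ ⊤)
... | true  = cong (term S (h ∘ (inside ∷_)) T ℚ.+_) (altSum-out-in S h xs)
... | false = altSum-out-in S h xs

altSum-in-out : ∀ {n} (S : Subset n) h xs →
  altSum (inside ∷ S) h (map (outside ∷_) xs) ≡ altSum S (h ∘ (outside ∷_)) xs
altSum-in-out S h []       = refl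
altSum-in-out S h (T ∷ xs) with does ((S ∪ T) ≟ˢ ⊤)
... | true  = cong (term S (h ∘ (outside ∷_)) T ℚ.+_) (altSum-in-out S h xs)
... | false = altSum-in-out S h xs

-1^ : ∀ k → (-1ℤ ℤ.^ k ≡ 1ℤ) ⊎ (-1ℤ ℤ.^ k ≡ -1ℤ)
-1^ ℕ.zero = inj₁ refl
-1^ (ℕ.suc k) with -1^ k
... | inj₁ eq = inj₂ (cong (-1ℤ ℤ.*_) eq)
... | inj₂ eq = inj₁ (cong (-1ℤ ℤ.*_) eq)

-- A power of -1 takes only two values, and for each of them both sides compute.
sign-suc : ∀ k → (-1ℤ ℤ.^ ℕ.suc k) ℚ./ 1 ≡ ℚ.- ((-1ℤ ℤ.^ k) ℚ./ 1)
sign-suc k with -1ℤ ℤ.^ k | -1^ k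
... | _ | inj₁ refl = refl
... | _ | inj₂ refl = refl

-- The common head adds one to the size of the intersection, which flips every sign.
altSum-in-in : ∀ {n} (S : Subset n) h xs →
  altSum (inside ∷ S) h (map (inside ∷_) xs) ≡ ℚ.- altSum S (h ∘ (inside ∷_)) xs
altSum-in-in S h []       = refl
altSum-in-in S h (T ∷ xs) with does ((S ∪ T) ≟ˢ ⊤)
... | true  = trans
  (cong₂ ℚ._+_
    (trans (cong (ℚ._* h (inside ∷ T)) (sign-suc (ℕ.suc (Subset.∣ S ∩ T ∣))))
           (sym (ℚ.neg-distribˡ-* (((-1ℤ ℤ.^ ℕ.suc (Subset.∣ S ∩ T ∣)) ℚ./ 1)) (h (inside ∷ T)))))
    (altSum-in-in S h xs))
  (sym (ℚ.neg-distrib-+ (term S (h ∘ (inside ∷_)) T) _))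
... | false = altSum-in-in S h xs

-- Recursion for the W-coefficients on the first element

wℚ : ∀ {n} → Subset n → (Subset n → ℚ) → ℚ
wℚ {n} S h = altSum S h (subsets n)

seq-wCoeff : ∀ {n} (f : SetFunction n) S i → seq (wCoeff f S) i ≡ wℚ S (λ T → seq (value f T) i)
seq-wCoeff {n} f S i =
  seq-sumᴿ (λ T → ((-1ℤ ℤ.^ ℕ.suc (Subset.∣ S ∩ T ∣)) ℚ./ 1) • value f T) i
    (filter (λ T → (S ∪ T) ≟ˢ ⊤) (subsets n))

-- If `S` misses the first element, the covering condition forces `T` to contain it.
wℚ-outside : ∀ {n} (S : Subset n) h → wℚ (outside ∷ S) h ≡ wℚ S (h ∘ (inside ∷_))
wℚ-outside {n} S h = trans
  (altSum-++ (outside ∷ S) h (map (outside ∷_) (subsets n)) _)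
  (trans (cong₂ ℚ._+_ (altSum-out-out S h (subsets n)) (altSum-out-in S h (subsets n)))
         (ℚ.+-identityˡ _))

-- If `S` contains the first element, `T` may or may not contain it; the sets that do carry one
-- extra sign.
wℚ-inside : ∀ {n} (S : Subset n) h →
  wℚ (inside ∷ S) h ≡ wℚ S (h ∘ (outside ∷_)) ℚ.- wℚ S (h ∘ (inside ∷_))
wℚ-inside {n} S h = trans
  (altSum-++ (inside ∷ S) h (map (outside ∷_) (subsets n)) _)
  (cong₂ ℚ._+_ (altSum-in-out S h (subsets n)) (altSum-in-in S h (subsets n)))

wℚ-0 : ∀ {n} (S : Subset n) → wℚ S (λ _ → 0ℚ) ≡ 0ℚ
wℚ-0 []            = refl
wℚ-0 (outside ∷ S) = trans (wℚ-outside S _) (wℚ-0 S)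
wℚ-0 (inside ∷ S)  = trans (wℚ-inside S _) (ℚ.+-inverseʳ (wℚ S (λ _ → 0ℚ)))

-- Only the full set covers together with `⊥`, and its sign is -1.
wℚ-1-⊥ : ∀ n → wℚ (⊥ {n}) (λ _ → 1ℚ) ≡ ℚ.- 1ℚ
wℚ-1-⊥ ℕ.zero    = refl
wℚ-1-⊥ (ℕ.suc n) = trans (wℚ-outside (⊥ {n}) _) (wℚ-1-⊥ n)

-- Toggling an element of `S` in `T` preserves the covering condition and flips the sign, so the
-- terms cancel in pairs.
wℚ-1-nonempty : ∀ {n} (S : Subset n) → Nonempty S → wℚ S (λ _ → 1ℚ) ≡ 0ℚ
wℚ-1-nonempty (inside ∷ S)  _ = trans (wℚ-inside S _) (ℚ.+-inverseʳ (wℚ S (λ _ → 1ℚ)))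
wℚ-1-nonempty (outside ∷ S) (Fin.suc i , i∈) =
  trans (wℚ-outside S _) (wℚ-1-nonempty S (i , drop-there i∈))

-- The extremal set function

nonemptyInd : ∀ {n} → Subset n → ℚ
nonemptyInd []            = 0ℚ
nonemptyInd (outside ∷ T) = nonemptyInd T
nonemptyInd (inside ∷ T)  = 1ℚ

0≤nonemptyInd : ∀ {n} (T : Subset n) → 0ℚ ℚ.≤ nonemptyInd T
0≤nonemptyInd []            = ℚ.≤-refl
0≤nonemptyInd (outside ∷ T) = 0≤nonemptyInd T
0≤nonemptyInd (inside ∷ T)  = from-yes (0ℚ ℚ.≤? 1ℚ)

nonemptyInd-⊥ : ∀ n → nonemptyInd (⊥ {n}) ≡ 0ℚ
nonemptyInd-⊥ ℕ.zero    = refl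
nonemptyInd-⊥ (ℕ.suc n) = nonemptyInd-⊥ n

nonemptySubsets-spec : ∀ {n} (T : Subset n) →
  (nonemptyInd T ≡ 1ℚ × T ∈ˡ nonemptySubsets n) ⊎ (nonemptyInd T ≡ 0ℚ × ¬ (T ∈ˡ nonemptySubsets n))
nonemptySubsets-spec [] = inj₂ (refl , λ ())
nonemptySubsets-spec (inside ∷ T) = inj₁ (refl , ∈-++⁺ʳ _ (∈-map⁺ (inside ∷_) (∈-subsets T)))
nonemptySubsets-spec {ℕ.suc n} (outside ∷ T) with nonemptySubsets-spec T
... | inj₁ (eq , T∈) = inj₁ (eq , ∈-++⁺ˡ (∈-map⁺ (outside ∷_) T∈))
... | inj₂ (eq , T∉) = inj₂ (eq , λ T∈ → outside-case (∈-++⁻ (map (outside ∷_) (nonemptySubsets n)) T∈))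
  where
  outside-case : ¬ (outside ∷ T ∈ˡ map (outside ∷_) (nonemptySubsets n) ⊎ outside ∷ T ∈ˡ map (inside ∷_) (subsets n))
  outside-case (inj₁ p) with ∈-map⁻ (outside ∷_) p
  ... | _ , T∈ , refl = T∉ T∈
  outside-case (inj₂ p) with ∈-map⁻ (inside ∷_) p
  ... | _ , _ , ()

-- The two functions differ only at the empty set, which enters only the coefficient of the full
-- set, with sign -1. Lowering the value there from 1 to 0 can therefore only raise a coefficient.
wℚ-1≤wℚ-nonemptyInd : ∀ {n} (S : Subset n) → wℚ S (λ _ → 1ℚ) ℚ.≤ wℚ S nonemptyInd
wℚ-1≤wℚ-nonemptyInd []            = from-yes (ℚ.- 1ℚ ℚ.≤? 0ℚ)
wℚ-1≤wℚ-nonemptyInd (outside ∷ S) = ℚ.≤-reflexive (trans (wℚ-outside S _) (sym (wℚ-outside S _)))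
wℚ-1≤wℚ-nonemptyInd (inside ∷ S)  = subst₂ ℚ._≤_ (sym (wℚ-inside S _)) (sym (wℚ-inside S nonemptyInd))
  (ℚ.+-monoˡ-≤ (ℚ.- wℚ S (λ _ → 1ℚ)) (wℚ-1≤wℚ-nonemptyInd S))

-- The fixed element e is the head of the vector.
avoidInd : ∀ {n} → Subset (ℕ.suc n) → ℚ
avoidInd (outside ∷ T) = nonemptyInd T
avoidInd (inside ∷ T)  = 0ℚ

0≤avoidInd : ∀ {n} (T : Subset (ℕ.suc n)) → 0ℚ ℚ.≤ avoidInd T
0≤avoidInd (outside ∷ T) = 0≤nonemptyInd T
0≤avoidInd (inside ∷ T)  = ℚ.≤-refl

-- W-coefficients of the extremal function

wℚ-avoidInd-outside : ∀ {n} (S : Subset n) → wℚ (outside ∷ S) avoidInd ≡ 0ℚ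
wℚ-avoidInd-outside S = trans (wℚ-outside S avoidInd) (wℚ-0 S)

-- The sets containing e drop out because the function vanishes on them.
wℚ-avoidInd-inside : ∀ {n} (S : Subset n) → wℚ (inside ∷ S) avoidInd ≡ wℚ S nonemptyInd
wℚ-avoidInd-inside S = begin
    wℚ (inside ∷ S) avoidInd                   ≡⟨ wℚ-inside S avoidInd ⟩
    wℚ S nonemptyInd ℚ.- wℚ S (λ _ → 0ℚ)       ≡⟨ cong (λ z → wℚ S nonemptyInd ℚ.- z) (wℚ-0 S) ⟩
    wℚ S nonemptyInd ℚ.+ 0ℚ                    ≡⟨ ℚ.+-identityʳ _ ⟩
    wℚ S nonemptyInd                           ∎
  where open ≡-Reasoning

avoid : ∀ n → SetFunction (ℕ.suc n)
avoid n = record { value = ι ∘ avoidInd ; nonNeg = λ T → ι-mono-≤ 0ℚ (avoidInd T) (0≤avoidInd T) }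

avoid-⊥ : ∀ n → value (avoid n) ⊥ ≈ 0ᴿ
avoid-⊥ n = subst (λ q → ι q ≈ 0ᴿ) (sym (nonemptyInd-⊥ n)) (≈-refl {0ᴿ})

seq-wCoeff-avoid : ∀ {n} (S : Subset (ℕ.suc n)) i → seq (wCoeff (avoid n) S) i ≡ wℚ S avoidInd
seq-wCoeff-avoid {n} S i = trans (seq-wCoeff (avoid n) S i)
  (cong (wℚ S) {λ T → seq (value (avoid n) T) i} {avoidInd} refl)

wCoeff-avoid-neg : ∀ {n} {S : Subset (ℕ.suc n)} → wCoeff (avoid n) S <ᴿ 0ᴿ → wℚ S avoidInd ℚ.< 0ℚ
wCoeff-avoid-neg {n} {S} (ε , ε>0 , N , p) = begin-strict
    w              ≡⟨ ℚ.+-identityʳ w ⟨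
    w ℚ.+ 0ℚ       <⟨ ℚ.+-monoʳ-< w ε>0 ⟩
    w ℚ.+ ε        ≡⟨ cong (ℚ._+ ε) (seq-wCoeff-avoid S N) ⟨
    seq (wCoeff (avoid n) S) N ℚ.+ ε ≤⟨ p N ℕ.≤-refl ⟩
    0ℚ             ∎
  where
  open ℚ.≤-Reasoning
  w = wℚ S avoidInd

wCoeff-avoid-singleton : ∀ n → wCoeff (avoid (ℕ.suc n)) (inside ∷ ⊥) <ᴿ 0ᴿ
-- The coefficient is exactly -1, so the margin 1 is met with equality.
wCoeff-avoid-singleton n = 1ℚ , ℚ.positive⁻¹ 1ℚ , 0 , λ i _ →
  ℚ.≤-reflexive (cong (ℚ._+ 1ℚ) (begin
    seq (wCoeff (avoid (ℕ.suc n)) (inside ∷ ⊥)) i   ≡⟨ seq-wCoeff-avoid (inside ∷ ⊥ {ℕ.suc n}) i ⟩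
    wℚ (inside ∷ ⊥ {ℕ.suc n}) avoidInd              ≡⟨ wℚ-avoidInd-inside (⊥ {ℕ.suc n}) ⟩
    -- This uses an element other than e: `T` must contain it, which makes the indicator constantly
    -- 1.
    wℚ (⊥ {ℕ.suc n}) nonemptyInd                    ≡⟨ wℚ-outside (⊥ {n}) nonemptyInd ⟩
    wℚ (⊥ {n}) (λ _ → 1ℚ)                           ≡⟨ wℚ-1-⊥ n ⟩
    ℚ.- 1ℚ                                          ∎))
  where open ≡-Reasoning

-- For non-empty `S` the coefficient is at least that of the constant 1, which is 0.
wℚ-nonemptyInd-neg⇒⊥ : ∀ {n} (S : Subset n) → wℚ S nonemptyInd ℚ.< 0ℚ → S ≡ ⊥
wℚ-nonemptyInd-neg⇒⊥ S w<0 = Empty-unique λ S≠∅ → ℚ.<⇒≢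
  (ℚ.<-≤-trans w<0 (subst (ℚ._≤ wℚ S nonemptyInd) (wℚ-1-nonempty S S≠∅) (wℚ-1≤wℚ-nonemptyInd S))) refl

wℚ-avoidInd-neg⇒singleton : ∀ {n} (S : Subset (ℕ.suc n)) → wℚ S avoidInd ℚ.< 0ℚ → S ≡ inside ∷ ⊥
wℚ-avoidInd-neg⇒singleton (outside ∷ S) w<0 =
  contradiction (wℚ-avoidInd-outside S) (ℚ.<⇒≢ w<0)
wℚ-avoidInd-neg⇒singleton (inside ∷ S) w<0 =
  cong (inside ∷_) (wℚ-nonemptyInd-neg⇒⊥ S (subst (ℚ._< 0ℚ) (wℚ-avoidInd-inside S) w<0))

avoid-WDistance : ∀ n → WDistance (avoid (ℕ.suc n)) (1 over (2 ^ (2 ℕ.+ n) ℕ.∸ 1))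
avoid-WDistance n = 1 ,
  ( (inside ∷ ⊥) ∷ []
  , All.[] ∷ []
  , (λ S → mk⇔ (λ (_ , w<0) → here (wℚ-avoidInd-neg⇒singleton S (wCoeff-avoid-neg {S = S} w<0)))
               (λ { (here refl) → (Fin.zero , Vec.here) , wCoeff-avoid-singleton n }))
  , refl)
  , refl

-- Distance of the extremal function to coverage

zeroFn : ∀ m → SetFunction m
zeroFn m = record { value = λ _ → 0ᴿ ; nonNeg = λ _ → ≤ᴿ-refl {0ᴿ} }

zeroFn-coverage : ∀ m → IsCoverage (zeroFn m)
zeroFn-coverage m = 0 , (λ ()) , (λ _ → []) , (λ ()) , λ T → ≈-refl {0ᴿ}

avoid-Hamming-zeroFn : ∀ n →
  Hamming (avoid n) (zeroFn (ℕ.suc n)) (length (nonemptySubsets n) over (2 ^ ℕ.suc n))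
avoid-Hamming-zeroFn n = _ ,
  ( map (outside ∷_) (nonemptySubsets n)
  , Unique.map⁺ ∷-injectiveʳ (nonemptySubsets-unique n)
  , (λ T → mk⇔ (to T) (from T))
  , length-map (outside ∷_) (nonemptySubsets n))
  , refl
  where
  to : ∀ T → ¬ (ι (avoidInd T) ≈ 0ᴿ) → T ∈ˡ map (outside ∷_) (nonemptySubsets n)
  to (inside ∷ T) f≉0 = absurd (f≉0 (≈-refl {0ᴿ}))
  to (outside ∷ T) f≉0 with nonemptySubsets-spec T
  ... | inj₁ (_ , T∈) = ∈-map⁺ (outside ∷_) T∈
  ... | inj₂ (eq , _) = absurd (f≉0 (subst (λ q → ι q ≈ 0ᴿ) (sym eq) (≈-refl {0ᴿ})))
  from : ∀ T → T ∈ˡ map (outside ∷_) (nonemptySubsets n) → ¬ (ι (avoidInd T) ≈ 0ᴿ)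
  from T T∈ f≈0 with ∈-map⁻ (outside ∷_) T∈
  ... | T′ , T′∈ , refl with nonemptySubsets-spec T′
  ...   | inj₁ (eq , _) = ι1≰ι0 (≈⇒≤ᴿ {ι 1ℚ} {0ᴿ} (subst (λ q → ι q ≈ 0ᴿ) eq f≈0))
  ...   | inj₂ (_ , T′∉) = T′∉ T′∈

≈1-≰-≈0 : ∀ {a b x y} → a ≡ ι 1ℚ → b ≡ ι 0ℚ → a ≈ x → b ≈ y → ¬ (x ≤ᴿ y)
≈1-≰-≈0 {x = x} {y} refl refl 1≈x 0≈y x≤y = ι1≰ι0
  (≤ᴿ-trans {ι 1ℚ} {x} {0ᴿ} (≈⇒≤ᴿ {ι 1ℚ} {x} 1≈x)
    (≤ᴿ-trans {x} {y} {0ᴿ} x≤y (≈⇒≤ᴿ {y} {0ᴿ} (≈-sym {0ᴿ} {y} 0≈y))))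

-- Dropping the head sends both members of a pair to the same `T`, so every non-empty `T` occurs
-- among the tails of `ys`. The hypothesis is doubly negated because `≈` on reals is not decidable;
-- list membership is decidable, which recovers a positive answer.
hits-all-pairs⇒length≥ : ∀ {n} (ys : List (Subset (ℕ.suc n))) →
  (∀ T → nonemptyInd T ≡ 1ℚ → ¬ (outside ∷ T ∈ˡ ys) → ¬ ¬ (inside ∷ T ∈ˡ ys)) →
  length (nonemptySubsets n) ≤ length ys
hits-all-pairs⇒length≥ {n} ys hits = subst (length (nonemptySubsets n) ≤_) (length-map Vec.tail ys)
  (Unique⇒length≤ (nonemptySubsets-unique n) (map Vec.tail ys) ∈-tails)
  where
  open import Data.List.Membership.DecPropositional (_≟ˢ_ {ℕ.suc n}) using () renaming (_∈?_ to _∈ˡ?_)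
  ∈-tails : ∀ {T} → T ∈ˡ nonemptySubsets n → T ∈ˡ map Vec.tail ys
  ∈-tails {T} T∈ with (outside ∷ T) ∈ˡ? ys | (inside ∷ T) ∈ˡ? ys | nonemptySubsets-spec T
  ... | yes p | _     | _               = ∈-map⁺ Vec.tail p
  ... | no _  | yes p | _               = ∈-map⁺ Vec.tail p
  ... | no _  | no _  | inj₂ (_ , T∉)   = contradiction T∈ T∉
  ... | no p₀ | no p₁ | inj₁ (eq , _)   = contradiction p₁ (hits T eq p₀)

avoid-Hamming-coverage : ∀ n (g : SetFunction (ℕ.suc n)) → IsCoverage g → ∀ q →
  Hamming (avoid n) g q → length (nonemptySubsets n) over (2 ^ ℕ.suc n) ℚ.≤ q
avoid-Hamming-coverage n g cov q (k , (ys , _ , spec , refl) , refl) =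
  over-mono-≤ (length (nonemptySubsets n)) (length ys) D D {{D≢0}} {{D≢0}}
    (ℕ.*-monoˡ-≤ D (hits-all-pairs⇒length≥ ys hits))
  where
  D = 2 ^ ℕ.suc n
  D≢0 = ℕ.m^n≢0 2 (ℕ.suc n)
  -- The list contains every point of disagreement, so absence from it refutes disagreement; this
  -- gives `≈` only under a double negation.
  agree : ∀ T → ¬ (T ∈ˡ ys) → ¬ ¬ (value (avoid n) T ≈ value g T)
  agree T T∉ f≉g = T∉ (Equivalence.to (spec T) f≉g)
  hits : ∀ T → nonemptyInd T ≡ 1ℚ → ¬ (outside ∷ T ∈ˡ ys) → ¬ ¬ (inside ∷ T ∈ˡ ys)
  -- If both members of the pair were missed, `g` would drop from 1 to 0 on a larger set, against
  -- monotonicity.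
  hits T eq p₀ p₁ = agree (outside ∷ T) p₀ λ f≈g₀ → agree (inside ∷ T) p₁ λ f≈g₁ →
    ≈1-≰-≈0 {value (avoid n) (outside ∷ T)} {value (avoid n) (inside ∷ T)}
      {value g (outside ∷ T)} {value g (inside ∷ T)} (cong ι eq) refl f≈g₀ f≈g₁
      (coverage-mono g cov {outside ∷ T} {inside ∷ T} (out⊆ ⊆-refl))

avoid-CoverageDistance : ∀ n →
  CoverageDistance (avoid n) (length (nonemptySubsets n) over (2 ^ ℕ.suc n))
avoid-CoverageDistance n =
  (zeroFn (ℕ.suc n) , zeroFn-coverage (ℕ.suc n) , avoid-Hamming-zeroFn n) , avoid-Hamming-coverage n

-- Numerical bounds

2^m≤m²*[2^m∸1] : ∀ n → 1 ℕ.* 2 ^ (2 ℕ.+ n) ≤ (2 ℕ.+ n) ^ 2 ℕ.* (2 ^ (2 ℕ.+ n) ℕ.∸ 1)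
2^m≤m²*[2^m∸1] n = begin
    1 ℕ.* P                          ≡⟨ ℕ.*-identityˡ P ⟩
    P                                ≡⟨ ℕ.m+[n∸m]≡n 1≤P ⟨
    -- The summand 1 is absorbed by `P ℕ.∸ 1`, which is at least 1.
    1 ℕ.+ (P ℕ.∸ 1)                  ≤⟨ ℕ.+-monoˡ-≤ (P ℕ.∸ 1) (ℕ.∸-monoˡ-≤ 1 2≤P) ⟩
    (P ℕ.∸ 1) ℕ.+ (P ℕ.∸ 1)          ≡⟨ cong ((P ℕ.∸ 1) ℕ.+_) (ℕ.+-identityʳ (P ℕ.∸ 1)) ⟨
    2 ℕ.* (P ℕ.∸ 1)                  ≤⟨ ℕ.*-monoˡ-≤ (P ℕ.∸ 1) 2≤m² ⟩
    (2 ℕ.+ n) ^ 2 ℕ.* (P ℕ.∸ 1)      ∎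
  where
  open ℕ.≤-Reasoning
  P = 2 ^ (2 ℕ.+ n)
  2≤P : 2 ≤ P
  2≤P = ℕ.^-monoʳ-≤ 2 {1} {2 ℕ.+ n} (ℕ.s≤s ℕ.z≤n)
  1≤P : 1 ≤ P
  1≤P = ℕ.≤-trans (ℕ.s≤s ℕ.z≤n) 2≤P
  2≤m² : 2 ≤ (2 ℕ.+ n) ^ 2
  2≤m² = ℕ.≤-trans (ℕ.s≤s (ℕ.s≤s ℕ.z≤n)) (ℕ.^-monoˡ-≤ 2 (ℕ.m≤m+n 2 n))

-- With m = n + 2, the sets that contain one given element other than e and avoid e already number
-- 2^(m-2), a quarter of all subsets.
2^m≤4*nonempty : ∀ n → 1 ℕ.* 2 ^ (2 ℕ.+ n) ≤ length (nonemptySubsets (ℕ.suc n)) ℕ.* 4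
2^m≤4*nonempty n = begin
    1 ℕ.* 2 ^ (2 ℕ.+ n)     ≡⟨ ℕ.*-identityˡ (2 ^ (2 ℕ.+ n)) ⟩
    2 ℕ.* (2 ℕ.* 2 ^ n)     ≡⟨ ℕ.*-assoc 2 2 (2 ^ n) ⟨
    4 ℕ.* 2 ^ n             ≡⟨ ℕ.*-comm 4 (2 ^ n) ⟩
    2 ^ n ℕ.* 4             ≤⟨ ℕ.*-monoˡ-≤ 4 2^n≤ ⟩
    length (nonemptySubsets (ℕ.suc n)) ℕ.* 4 ∎
  where
  open ℕ.≤-Reasoning
  2^n≤ : 2 ^ n ≤ length (nonemptySubsets (ℕ.suc n))
  2^n≤ = subst₂ _≤_ (length-subsets n) (sym (length-outside++inside (nonemptySubsets n) (subsets n)))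
    (ℕ.m≤n+m (length (subsets n)) (length (nonemptySubsets n)))

ι-≤-•1 : ∀ p q → p ℚ.≤ q → ι p ≤ᴿ q • ι 1ℚ
ι-≤-•1 p q p≤q = ι-mono-≤ p (q ℚ.* 1ℚ) (subst (p ℚ.≤_) (sym (ℚ.*-identityʳ q)) p≤q)

WDistance-bound : ∀ n → ι (1 over (2 ^ (2 ℕ.+ n) ℕ.∸ 1)) ≤ᴿ (((2 ℕ.+ n) ^ 2) over (2 ^ (2 ℕ.+ n))) • ι 1ℚ
WDistance-bound n = ι-≤-•1 _ _
  (over-mono-≤ 1 ((2 ℕ.+ n) ^ 2) (2 ^ (2 ℕ.+ n) ℕ.∸ 1) (2 ^ (2 ℕ.+ n))
    {{ℕ.>-nonZero (ℕ.∸-monoˡ-≤ 1 (ℕ.^-monoʳ-≤ 2 {1} {2 ℕ.+ n} (ℕ.s≤s ℕ.z≤n)))}}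
    {{ℕ.m^n≢0 2 (2 ℕ.+ n)}} (2^m≤m²*[2^m∸1] n))

CoverageDistance-bound : ∀ n →
  ι (1 over 4) ≤ᴿ ι (length (nonemptySubsets (ℕ.suc n)) over (2 ^ (2 ℕ.+ n)))
CoverageDistance-bound n = ι-mono-≤ (1 over 4) _
  (over-mono-≤ 1 (length (nonemptySubsets (ℕ.suc n))) 4 (2 ^ (2 ℕ.+ n))
    {{_}} {{ℕ.m^n≢0 2 (2 ℕ.+ n)}} (2^m≤4*nonempty n))

lemma4p2 : Σ ℝ λ C → Σ ℝ λ c → Σ ℕ λ m₀ →
    (0ᴿ <ᴿ C) × (0ᴿ <ᴿ c) ×
    (∀ (m : ℕ) → m₀ ≤ m →
    Σ (SetFunction m) λ f →
    (value f ⊥ ≈ 0ᴿ) ×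
    (Σ ℚ λ q → WDistance f q × (ι q ≤ᴿ ((m ^ 2) over (2 ^ m)) • C)) ×
    (Σ ℚ λ d → CoverageDistance f d × (c ≤ᴿ ι d)))
lemma4p2 =
  -- The constant C = 1 works because 1/(2^m - 1) is at most 2/2^m, and m^2 is at least 2. The
  -- distance is (2^(m-1) - 1)/2^m, which equals 1/4 at m = 2. Starting at 2 provides an element
  -- besides e.
  ι 1ℚ , ι (1 over 4) , 2 ,
  ι-mono-< 0ℚ 1ℚ (ℚ.positive⁻¹ 1ℚ) ,
  ι-mono-< 0ℚ (1 over 4) (ℚ.positive⁻¹ (1 over 4)) ,
  λ where
    (ℕ.suc (ℕ.suc n)) _ →
      avoid (ℕ.suc n) ,
      avoid-⊥ (ℕ.suc n) ,
      (_ , avoid-WDistance n , WDistance-bound n) ,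
      (_ , avoid-CoverageDistance (ℕ.suc n) , CoverageDistance-bound n)
    (ℕ.suc ℕ.zero) (ℕ.s≤s ())
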